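{- For every positive integer $n$, the number of circular permutations of $[n]=\{1,2,\ldots,n\}$ that avoid the pattern $1342$ equals $2^{n-1}-(n-1)$.
   Context: A circular permutation of $[n]$ is an arrangement of $1,2,\ldots,n$ clockwise around a circle, two arrangements being identified if they differ by a rotation. Equivalently, it can be represented uniquely as a linear permutation $\pi_1\pi_2\cdots\pi_n$ of $[n]$ with $\pi_n=n$, whose rotations all represent the same circular permutation. The reduced form of a sequence of distinct positive integers is obtained by replacing its smallest entry by $1$, its next smallest by $2$, and so on; a pattern is such a reduced form. An occurrence of a pattern $\tau$ of length $m$ in a circular permutation $\pi$ is a sequence of $m$ letters of $\pi$ read in clockwise order and lying within one revolution (i.e., a subsequence of some rotation of the linear representation) whose reduced form is $\tau$; $\pi$ avoids $\tau$ if it has no occurrence of $\tau$. -}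

module Defs where

open import Level using (0ℓ)
open import Data.Nat using (ℕ; suc; _≤?_)
open import Data.Fin using (Fin)
open import Data.List using (List; []; _∷_; _++_; length; map; filter; applyUpTo)
open import Data.List.Properties using (++-assoc; ++-identityʳ; ∷-injective)
open import Data.List.Relation.Binary.Permutation.Propositional using (_↭_)
open import Data.List.Relation.Binary.Sublist.Propositional using (_⊆_)
open import Data.Product using (∃; ∃₂; _×_; _,_; proj₁)
open import Data.Sum using (_⊎_; inj₁; inj₂)
open import Function.Bundles using (Inverse)
open import Relation.Binary.Bundles using (Setoid)
import Relation.Binary.Construct.On as On
open import Relation.Binary.PropositionalEquality
  using (_≡_; refl; sym; cong; setoid)
open import Relation.Nullary using (¬_)

infix 4 _≈ʳ_

_≈ʳ_ : List ℕ → List ℕ → Set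
xs ≈ʳ ys = ∃₂ λ us vs → xs ≡ us ++ vs × ys ≡ vs ++ us

≈ʳ-refl : ∀ {xs} → xs ≈ʳ xs
≈ʳ-refl {xs} = [] , xs , refl , sym (++-identityʳ xs)

≈ʳ-sym : ∀ {xs ys} → xs ≈ʳ ys → ys ≈ʳ xs
≈ʳ-sym (us , vs , p , q) = vs , us , q , p

private
  align : ∀ (as : List ℕ) {bs} cs {ds} → as ++ bs ≡ cs ++ ds →
            (∃ λ es → cs ≡ as ++ es × bs ≡ es ++ ds) ⊎
            (∃ λ es → as ≡ cs ++ es × ds ≡ es ++ bs)
  align []       cs       eq = inj₁ (cs , refl , eq)
  align (a ∷ as) []       eq = inj₂ (a ∷ as , refl , sym eq)
  align (a ∷ as) (c ∷ cs) eq with ∷-injective eq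
  ... | refl , eq′ with align as cs eq′
  ...   | inj₁ (es , p , q) = inj₁ (es , cong (a ∷_) p , q)
  ...   | inj₂ (es , p , q) = inj₂ (es , cong (a ∷_) p , q)

≈ʳ-trans : ∀ {xs ys zs} → xs ≈ʳ ys → ys ≈ʳ zs → xs ≈ʳ zs
≈ʳ-trans (us , vs , refl , refl) (ws , ts , p , refl) with align vs ws p
... | inj₁ (es , refl , refl) =
  es , ts ++ vs , ++-assoc es ts vs , sym (++-assoc ts vs es)
... | inj₂ (es , refl , refl) =
  us ++ ws , es , sym (++-assoc us ws es) , ++-assoc es us ws

rotationSetoid : Setoid 0ℓ 0ℓ
rotationSetoid = record
  { Carrier       = List ℕ
  ; _≈_           = _≈ʳ_
  ; isEquivalence = record { refl = ≈ʳ-refl ; sym = ≈ʳ-sym ; trans = ≈ʳ-trans }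
  }

Arrangement : ℕ → Set
Arrangement n = ∃ λ (π : List ℕ) → π ↭ applyUpTo suc n

circularPermutations : ℕ → Setoid 0ℓ 0ℓ
circularPermutations n = On.setoid {B = Arrangement n} rotationSetoid proj₁

-- For distinct entries, the number of entries ≤ x is the rank of x,
-- counted from 1.
reduced : List ℕ → List ℕ
reduced xs = map (λ x → length (filter (_≤? x) xs)) xs

-- "In clockwise order, within one revolution": a sublist of some rotation.
Occurrence : List ℕ → List ℕ → Set
Occurrence τ π = ∃₂ λ ρ σ → π ≈ʳ ρ × σ ⊆ ρ × reduced σ ≡ τ

Avoids : List ℕ → List ℕ → Set
Avoids τ π = ¬ Occurrence τ π

Avoids-resp-≈ʳ : ∀ {τ xs ys} → xs ≈ʳ ys → Avoids τ xs → Avoids τ ys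
Avoids-resp-≈ʳ xs≈ys av (ρ , σ , ys≈ρ , rest) =
  av (ρ , σ , ≈ʳ-trans xs≈ys ys≈ρ , rest)

-- Equality ignores the proof of avoidance, so each circular permutation
-- is counted once.
avoiders : List ℕ → ℕ → Setoid 0ℓ 0ℓ
avoiders τ n =
  On.setoid {B = ∃ λ (c : Arrangement n) → Avoids τ (proj₁ c)}
            (circularPermutations n) proj₁

HasCardinality : Setoid 0ℓ 0ℓ → ℕ → Set
HasCardinality S k = Inverse S (setoid (Fin k))

{-# OPTIONS --safe #-}
module Submission where

-- Rotate the circle to n A 1 B.  Avoiding 4213 with n as its 4 means that
-- A 1 B avoids 213, so every entry of A exceeds every entry of B.  Avoiding
-- a 1342 starting at the 1 and a 3421 ending there makes B and A avoid 231 as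
-- well, i.e. each entry of A (of B) is the least or the greatest of those from
-- it onwards.  The one remaining obstruction is a 3421 with its 34 in A and its
-- 21 in B, so A is decreasing or B is increasing.  There are
-- g(k) = 2 ^ (k - 1) such words on k > 0 letters and g(0) = 1, exactly one of them
-- increasing and one decreasing, so the count is the sum of
-- g(a) + (g(b) - 1) over a + b = n - 2, which is 2 ^ (n - 1) - (n - 1).

open import Defs
open import Level using (0ℓ)
open import Data.Nat
open import Data.Nat.Properties
open import Data.Nat.Tactic.RingSolver using (solve-∀)
open import Data.Fin as Fin using (Fin)
open import Data.List using (List; []; _∷_; _++_; length; map; filter; applyUpTo; drop; lookup)
open import Data.List.Properties
  using (∷-injective; ∷-injectiveˡ; ∷-injectiveʳ; ++-identityʳ; ++-cancelˡ; ++-cancelʳ;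
         length-++; length-map; filter-accept; filter-reject)
open import Data.List.Membership.Propositional using (_∈_; _∉_; find)
open import Data.List.Membership.Propositional.Properties
  using (∈-lookup; ∈-++⁺ˡ; ∈-++⁺ʳ; ∈-++⁻; ∈-map⁺; ∈-map⁻; ∈-∃++; ∈-applyUpTo⁺; ∈-applyUpTo⁻)
open import Data.List.Membership.Propositional.Properties.WithK using (unique∧set⇒bag)
open import Data.List.Relation.Binary.BagAndSetEquality using (∼bag⇒↭)
open import Data.List.Relation.Binary.Disjoint.Propositional using (Disjoint)
open import Data.List.Relation.Binary.Permutation.Propositional using (_↭_; ↭-sym; ↭-trans; ↭-refl; ↭⇒↭ₛ)
import Data.List.Relation.Binary.Permutation.Setoid.Properties as Permutationₛ
open import Data.List.Relation.Binary.Permutation.Propositional.Properties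
  using (∈-resp-↭; ↭-singleton-inv) renaming (++-comm to ↭-++-comm)
open import Data.List.Relation.Binary.Sublist.Propositional
  using (_⊆_; []; _∷_; _∷ʳ_; ⊆-refl; ⊆-trans; minimum; from∈; to∈)
open import Data.List.Relation.Binary.Sublist.Propositional.Properties
  using (All-resp-⊆; ∷ˡ⁻; ++⁺; ++⁺ˡ; ++⁺ʳ)
open import Data.List.Relation.Unary.All as All using (All; []; _∷_)
open import Data.List.Relation.Unary.All.Properties using (¬All⇒Any¬)
open import Data.List.Relation.Unary.AllPairs as AllPairs using (AllPairs; []; _∷_)
open import Data.List.Relation.Unary.Any as Any using (here; there)
open import Data.List.Relation.Unary.Any.Properties using (lookup-index)
open import Data.List.Relation.Unary.Unique.Propositional using (Unique)
import Data.List.Relation.Unary.Unique.Propositional.Properties as Unique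
import Data.List.Extrema.Nat as Extrema
open import Data.List.Extrema ≤-totalOrder using (⊥≤max; xs≤max; argmax-all)
open import Data.Product using (∃; ∃₂; _×_; _,_; proj₁; proj₂)
open import Data.Sum using (_⊎_; inj₁; inj₂)
open import Function using (_∘_; id; mk⇔)
open import Relation.Binary using (Rel; Decidable; tri<; tri≈; tri>)
open import Relation.Binary.PropositionalEquality
open import Relation.Nullary using (¬_; yes; no; contradiction)

τ₁₃₄₂ : List ℕ
τ₁₃₄₂ = 1 ∷ 3 ∷ 4 ∷ 2 ∷ []

-- Sublists and pairwise relations

module _ {A : Set} where

  lookup-injective : ∀ {xs : List A} → Unique xs → ∀ {i j} → lookup xs i ≡ lookup xs j → i ≡ j
  lookup-injective (_  ∷ _) {Fin.zero}  {Fin.zero}  _  = refl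
  lookup-injective (px ∷ _) {Fin.zero}  {Fin.suc j} eq = contradiction eq (All.lookup px (∈-lookup j))
  lookup-injective (px ∷ _) {Fin.suc i} {Fin.zero}  eq =
    contradiction (sym eq) (All.lookup px (∈-lookup i))
  lookup-injective (_  ∷ u) {Fin.suc i} {Fin.suc j} eq = cong Fin.suc (lookup-injective u eq)

  ⊆-++⁻ : ∀ us {vs σ : List A} → σ ⊆ us ++ vs → ∃₂ λ σ₁ σ₂ → σ ≡ σ₁ ++ σ₂ × σ₁ ⊆ us × σ₂ ⊆ vs
  ⊆-++⁻ []       s = [] , _ , refl , [] , s
  ⊆-++⁻ (u ∷ us) (.u ∷ʳ s) with σ₁ , σ₂ , eq , s₁ , s₂ ← ⊆-++⁻ us s =
    σ₁ , σ₂ , eq , u ∷ʳ s₁ , s₂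
  ⊆-++⁻ (u ∷ us) (refl ∷ s) with σ₁ , σ₂ , refl , s₁ , s₂ ← ⊆-++⁻ us s =
    u ∷ σ₁ , σ₂ , refl , refl ∷ s₁ , s₂

  ++-⊆⁻ : ∀ us {vs xs : List A} → us ++ vs ⊆ xs → ∃₂ λ xs₁ xs₂ → xs ≡ xs₁ ++ xs₂ × us ⊆ xs₁ × vs ⊆ xs₂
  ++-⊆⁻ []       s = [] , _ , refl , [] , s
  ++-⊆⁻ (u ∷ us) (x ∷ʳ s) with xs₁ , xs₂ , refl , s₁ , s₂ ← ++-⊆⁻ (u ∷ us) s =
    x ∷ xs₁ , xs₂ , refl , x ∷ʳ s₁ , s₂
  ++-⊆⁻ (u ∷ us) (refl ∷ s) with xs₁ , xs₂ , refl , s₁ , s₂ ← ++-⊆⁻ us s =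
    u ∷ xs₁ , xs₂ , refl , refl ∷ s₁ , s₂

  AllPairs-resp-⊆ : ∀ {R : Rel A 0ℓ} {xs ys} → xs ⊆ ys → AllPairs R ys → AllPairs R xs
  AllPairs-resp-⊆ []         []       = []
  AllPairs-resp-⊆ (_ ∷ʳ s)   (_ ∷ ps) = AllPairs-resp-⊆ s ps
  AllPairs-resp-⊆ (refl ∷ s) (p ∷ ps) = All-resp-⊆ s p ∷ AllPairs-resp-⊆ s ps

  AllPairs-lookup : ∀ {R : Rel A 0ℓ} {x y xs} → x ∷ y ∷ [] ⊆ xs → AllPairs R xs → R x y
  AllPairs-lookup s ps with (r ∷ []) ∷ _ ← AllPairs-resp-⊆ s ps = r

  -- Turns a failure of monotonicity into a concrete pair of letters, out of which a forbidden
  -- occurrence can be built.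
  AllPairs⊎⊆ : ∀ {R : Rel A 0ℓ} → Decidable R → ∀ xs →
               AllPairs R xs ⊎ ∃₂ λ x y → x ∷ y ∷ [] ⊆ xs × ¬ R x y
  AllPairs⊎⊆ R? []       = inj₁ []
  AllPairs⊎⊆ R? (x ∷ xs) with AllPairs⊎⊆ R? xs | All.all? (R? x) xs
  ... | inj₂ (y , z , s , ¬r) | _      = inj₂ (y , z , x ∷ʳ s , ¬r)
  ... | inj₁ ps               | yes px = inj₁ (px ∷ ps)
  ... | inj₁ _                | no ¬px =
    let y , y∈xs , ¬r = find (¬All⇒Any¬ (R? x) xs ¬px)
    in inj₂ (x , y , refl ∷ from∈ y∈xs , ¬r)

  -- Both prefixes end at the first `x` of the common list. With `x = 1` this recovers A and B from
  -- the word n A 1 B.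
  ++-∷-split : ∀ {x : A} xs ys {us vs} → x ∉ xs → x ∉ ys →
               xs ++ x ∷ us ≡ ys ++ x ∷ vs → xs ≡ ys × us ≡ vs
  ++-∷-split []       []       _  _  eq = refl , ∷-injectiveʳ eq
  ++-∷-split []       (y ∷ ys) _  ny eq = contradiction (here (∷-injectiveˡ eq)) ny
  ++-∷-split (x ∷ xs) []       nx _  eq = contradiction (here (sym (∷-injectiveˡ eq))) nx
  ++-∷-split (x ∷ xs) (y ∷ ys) nx ny eq with refl , eq′ ← ∷-injective eq
    with refl , us≡vs ← ++-∷-split xs ys (nx ∘ there) (ny ∘ there) eq′ = refl , us≡vs

-- Counting circular permutations by representatives

-- A circular permutation is sent to the position of its representative in `L`. The representative
-- found by `complete` may depend on the linear form and on the proofs, but any two choices are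
-- rotations of each other, hence equal by `distinct`, and sit at the same position since `L` has no
-- repetition.
listing⇒cardinality : ∀ {τ n} (L : List (List ℕ)) → Unique L →
  (∀ {l} → l ∈ L → l ↭ applyUpTo suc n × Avoids τ l) →
  (∀ {l l′} → l ∈ L → l′ ∈ L → l ≈ʳ l′ → l ≡ l′) →
  (∀ {π} → π ↭ applyUpTo suc n → Avoids τ π → ∃ λ l → l ∈ L × π ≈ʳ l) →
  HasCardinality (avoiders τ n) (length L)
listing⇒cardinality L unique sound distinct complete = record
  { to        = λ ((π , p) , av) → Any.index (proj₁ (proj₂ (complete p av)))
  ; from      = λ i → let p , av = sound (∈-lookup i) in (lookup L i , p) , av
  ; to-cong   = λ {((π , p) , av)} {((π′ , p′) , av′)} π≈π′ →
      let _ , l∈ , π≈ = complete p av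
          _ , l′∈ , π′≈ = complete p′ av′
      in lookup-injective unique (trans (sym (lookup-index l∈))
           (trans (distinct l∈ l′∈ (≈ʳ-trans (≈ʳ-sym π≈) (≈ʳ-trans π≈π′ π′≈))) (lookup-index l′∈)))
  ; from-cong = λ { refl → ≈ʳ-refl }
  ; inverse   =
      (λ {i} {((π , p) , av)} π≈ →
        let _ , l∈ , π≈l = complete p av
        in lookup-injective unique (trans (sym (lookup-index l∈))
             (distinct l∈ (∈-lookup i) (≈ʳ-trans (≈ʳ-sym π≈l) π≈))))
    , (λ { {((π , p) , av)} refl →
        let _ , l∈ , π≈l = complete p av
        in ≈ʳ-sym (subst (_ ≈ʳ_) (lookup-index l∈) π≈l) })
  }

-- A rotation with both pieces nonempty brings a letter of `xs` to the front, and that letter would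
-- be a second `n`.
≈ʳ-∷⇒≡ : ∀ {n xs ys} → n ∉ xs → n ∷ xs ≈ʳ n ∷ ys → n ∷ xs ≡ n ∷ ys
≈ʳ-∷⇒≡ _ ([] , vs , p , q) = trans p (sym (trans q (++-identityʳ vs)))
≈ʳ-∷⇒≡ _ (u ∷ us , [] , p , q) = trans (trans p (++-identityʳ (u ∷ us))) (sym q)
≈ʳ-∷⇒≡ n∉ (u ∷ us , v ∷ vs , p , q) =
  contradiction (subst (_ ∈_) (sym (∷-injectiveʳ p)) (∈-++⁺ʳ us (here (∷-injectiveˡ q)))) n∉

-- Rotating the pattern instead of the circle

-- The letters keep the names they have in the 1342 `a b c d`, so every constructor has the same
-- premises: `a`, `d`, `b`, `c` play 1, 2, 3, 4.
data Rotated1342 : List ℕ → Set where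
  r1342 : ∀ {a b c d} → a < d → d < b → b < c → Rotated1342 (a ∷ b ∷ c ∷ d ∷ [])
  r3421 : ∀ {a b c d} → a < d → d < b → b < c → Rotated1342 (b ∷ c ∷ d ∷ a ∷ [])
  r4213 : ∀ {a b c d} → a < d → d < b → b < c → Rotated1342 (c ∷ d ∷ a ∷ b ∷ [])
  r2134 : ∀ {a b c d} → a < d → d < b → b < c → Rotated1342 (d ∷ a ∷ b ∷ c ∷ [])

≈ʳ⇒Rotated1342 : ∀ {a b c d σ} → a < d → d < b → b < c → a ∷ b ∷ c ∷ d ∷ [] ≈ʳ σ → Rotated1342 σ
≈ʳ⇒Rotated1342 p q r ([] , _ , refl , refl) = r1342 p q r
≈ʳ⇒Rotated1342 p q r (_ ∷ [] , _ , refl , refl) = r3421 p q r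
≈ʳ⇒Rotated1342 p q r (_ ∷ _ ∷ [] , _ , refl , refl) = r4213 p q r
≈ʳ⇒Rotated1342 p q r (_ ∷ _ ∷ _ ∷ [] , _ , refl , refl) = r2134 p q r
≈ʳ⇒Rotated1342 p q r (_ ∷ _ ∷ _ ∷ _ ∷ [] , [] , refl , refl) = r1342 p q r
≈ʳ⇒Rotated1342 p q r (_ ∷ _ ∷ _ ∷ _ ∷ _ ∷ _ , _ , () , _)

rank : List ℕ → ℕ → ℕ
rank xs x = length (filter (_≤? x) xs)

rank-≤ : ∀ {x y ys k} → y ≤ x → rank ys x ≡ k → rank (y ∷ ys) x ≡ suc k
rank-≤ {x} {y} {ys} y≤x eq = trans (cong length (filter-accept (_≤? x) {y} {ys} y≤x)) (cong suc eq)

rank-> : ∀ {x y ys k} → x < y → rank ys x ≡ k → rank (y ∷ ys) x ≡ k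
rank-> {x} {y} {ys} x<y eq = trans (cong length (filter-reject (_≤? x) {y} {ys} (<⇒≱ x<y))) eq

-- Used in contrapositive form: a smaller rank forces a smaller letter, which lets the order of the
-- letters be read back from `reduced`.
rank-mono : ∀ xs {x y} → x ≤ y → rank xs x ≤ rank xs y
rank-mono []       x≤y = z≤n
rank-mono (z ∷ zs) {x} {y} x≤y with z ≤? x | z ≤? y
... | yes z≤x | no  z≰y = contradiction (≤-trans z≤x x≤y) z≰y
... | yes z≤x | yes z≤y =
  subst₂ _≤_ (sym (rank-≤ {x} {z} z≤x refl)) (sym (rank-≤ {y} {z} z≤y refl)) (s≤s (rank-mono zs x≤y))
... | no  z≰x | yes z≤y =
  subst₂ _≤_ (sym (rank-> {x} {z} (≰⇒> z≰x) refl)) (sym (rank-≤ {y} {z} z≤y refl))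
    (m≤n⇒m≤1+n (rank-mono zs x≤y))
... | no  z≰x | no  z≰y =
  subst₂ _≤_ (sym (rank-> {x} {z} (≰⇒> z≰x) refl)) (sym (rank-> {y} {z} (≰⇒> z≰y) refl))
    (rank-mono zs x≤y)

reduced-1342 : ∀ {a b c d} → a < d → d < b → b < c → reduced (a ∷ b ∷ c ∷ d ∷ []) ≡ τ₁₃₄₂
reduced-1342 {a} {b} {c} {d} a<d d<b b<c =
  cong₂ _∷_ (rank-≤ {a} {a} ≤-refl (rank-> {a} {b} a<b (rank-> {a} {c} a<c (rank-> {a} {d} a<d refl))))
  (cong₂ _∷_ (rank-≤ {b} {a} (<⇒≤ a<b) (rank-≤ {b} {b} ≤-refl (rank-> {b} {c} b<c (rank-≤ {b} {d} (<⇒≤ d<b) refl))))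
  (cong₂ _∷_ (rank-≤ {c} {a} (<⇒≤ a<c) (rank-≤ {c} {b} (<⇒≤ b<c) (rank-≤ {c} {c} ≤-refl (rank-≤ {c} {d} (<⇒≤ (<-trans d<b b<c)) refl))))
  (cong₂ _∷_ (rank-≤ {d} {a} (<⇒≤ a<d) (rank-> {d} {b} d<b (rank-> {d} {c} (<-trans d<b b<c) (rank-≤ {d} {d} ≤-refl refl))))
  refl)))
  where
  a<b = <-trans a<d d<b
  a<c = <-trans a<b b<c

reduced-1342⁻ : ∀ {σ} → reduced σ ≡ τ₁₃₄₂ →
  ∃₂ λ a b → ∃₂ λ c d → σ ≡ a ∷ b ∷ c ∷ d ∷ [] × a < d × d < b × b < c
reduced-1342⁻ {[]} ()
reduced-1342⁻ {_ ∷ []} eq with () ← cong length eq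
reduced-1342⁻ {_ ∷ _ ∷ []} eq with () ← cong length eq
reduced-1342⁻ {_ ∷ _ ∷ _ ∷ []} eq with () ← cong length eq
reduced-1342⁻ {_ ∷ _ ∷ _ ∷ _ ∷ _ ∷ _} eq with () ← cong length eq
reduced-1342⁻ {σ@(a ∷ b ∷ c ∷ d ∷ [])} eq
  with ra , eq₁ ← ∷-injective eq with rb , eq₂ ← ∷-injective eq₁
  with rc , eq₃ ← ∷-injective eq₂ with rd , _ ← ∷-injective eq₃ =
  a , b , c , d , refl , lt a d ra rd ≤-refl , lt d b rd rb ≤-refl , lt b c rb rc ≤-refl
  where
  lt : ∀ x y {i j} → rank σ x ≡ i → rank σ y ≡ j → i < j → x < y
  lt x y refl refl i<j = ≰⇒> (λ y≤x → <⇒≱ i<j (rank-mono σ y≤x))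

-- The cut of the rotation also cuts the sublist in two; exchanging its two pieces undoes the
-- rotation.
⊆-rotate : ∀ {xs ys σ} → xs ≈ʳ ys → σ ⊆ ys → ∃ λ σ′ → σ ≈ʳ σ′ × σ′ ⊆ xs
⊆-rotate (us , vs , refl , refl) s with σ₁ , σ₂ , refl , s₁ , s₂ ← ⊆-++⁻ vs s =
  σ₂ ++ σ₁ , (σ₁ , σ₂ , refl , refl) , ++⁺ s₂ s₁

⊆-rotate⁻ : ∀ {xs σ σ′} → σ ≈ʳ σ′ → σ ⊆ xs → ∃ λ ys → xs ≈ʳ ys × σ′ ⊆ ys
⊆-rotate⁻ (us , vs , refl , refl) s with xs₁ , xs₂ , refl , s₁ , s₂ ← ++-⊆⁻ us s =
  xs₂ ++ xs₁ , (xs₁ , xs₂ , refl , refl) , ++⁺ s₂ s₁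

-- Avoidance on the circle, tested on one fixed linear form: the rotations are moved from the word
-- to the pattern.
Clean : List ℕ → Set
Clean xs = ∀ {σ} → Rotated1342 σ → ¬ σ ⊆ xs

clean⇒avoids : ∀ {xs} → Clean xs → Avoids τ₁₃₄₂ xs
clean⇒avoids clean (ρ , σ , xs≈ρ , σ⊆ρ , eq)
  with a , b , c , d , refl , p , q , r ← reduced-1342⁻ eq
  with σ′ , σ≈σ′ , σ′⊆xs ← ⊆-rotate xs≈ρ σ⊆ρ =
  clean (≈ʳ⇒Rotated1342 p q r σ≈σ′) σ′⊆xs

avoids⇒clean : ∀ {xs} → Avoids τ₁₃₄₂ xs → Clean xs
avoids⇒clean {xs} av = λ where
    (r1342 p q r) → occ p q r ([] , _ , refl , refl)
    (r3421 {a} p q r) → occ p q r (a ∷ [] , _ , refl , refl)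
    (r4213 {a} {b} p q r) → occ p q r (a ∷ b ∷ [] , _ , refl , refl)
    (r2134 {a} {b} {c} p q r) → occ p q r (a ∷ b ∷ c ∷ [] , _ , refl , refl)
  where
  occ : ∀ {a b c d σ} → a < d → d < b → b < c → a ∷ b ∷ c ∷ d ∷ [] ≈ʳ σ → ¬ σ ⊆ xs
  occ {a} {b} {c} {d} p q r σ≈ σ⊆ =
    let ρ , xs≈ρ , s = ⊆-rotate⁻ (≈ʳ-sym σ≈) σ⊆
    in av (ρ , a ∷ b ∷ c ∷ d ∷ [] , xs≈ρ , s , reduced-1342 p q r)

Unique-resp-↭ : ∀ {xs ys : List ℕ} → xs ↭ ys → Unique xs → Unique ys
Unique-resp-↭ p =
  Permutationₛ.AllPairs-resp-↭ (setoid ℕ) ≢-sym (subst (_ ≢_) , subst (_≢ _)) (↭⇒↭ₛ p)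

-- Words avoiding 213 and 231

-- A last letter can be added by `min` as well as by `max`, so derivations are not unique and cannot
-- be counted in place of the words.
data Extremal : List ℕ → Set where
  []  : Extremal []
  min : ∀ {x xs} → All (x <_) xs → Extremal xs → Extremal (x ∷ xs)
  max : ∀ {x xs} → All (x >_) xs → Extremal xs → Extremal (x ∷ xs)

Extremal-resp-⊆ : ∀ {xs ys} → xs ⊆ ys → Extremal ys → Extremal xs
Extremal-resp-⊆ []         []        = []
Extremal-resp-⊆ (_ ∷ʳ s)   (min _ e) = Extremal-resp-⊆ s e
Extremal-resp-⊆ (_ ∷ʳ s)   (max _ e) = Extremal-resp-⊆ s e
Extremal-resp-⊆ (refl ∷ s) (min p e) = min (All-resp-⊆ s p) (Extremal-resp-⊆ s e)
Extremal-resp-⊆ (refl ∷ s) (max p e) = max (All-resp-⊆ s p) (Extremal-resp-⊆ s e)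

Extremal⇒Unique : ∀ {xs} → Extremal xs → Unique xs
Extremal⇒Unique []        = []
Extremal⇒Unique (min p e) = All.map <⇒≢ p ∷ Extremal⇒Unique e
Extremal⇒Unique (max p e) = All.map >⇒≢ p ∷ Extremal⇒Unique e

Extremal-¬213 : ∀ {x y z xs} → Extremal xs → x ∷ y ∷ z ∷ [] ⊆ xs → y < x → ¬ x < z
Extremal-¬213 e s y<x x<z with Extremal-resp-⊆ s e
... | min (x<y ∷ _) _     = <-asym x<y y<x
... | max (_ ∷ z<x ∷ []) _ = <-asym x<z z<x

Extremal-¬231 : ∀ {x y z xs} → Extremal xs → x ∷ y ∷ z ∷ [] ⊆ xs → z < x → ¬ x < y
Extremal-¬231 e s z<x x<y with Extremal-resp-⊆ s e
... | min (_ ∷ x<z ∷ []) _ = <-asym x<z z<x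
... | max (y<x ∷ _) _     = <-asym x<y y<x

-- The second letter `y` decides the role of the head `x`. If `x < y`, a later `z < x` would
-- complete a 231; if `y < x`, a later `z > x` would complete a 213.
¬213∧¬231⇒Extremal : ∀ {xs} → Unique xs →
  (∀ {x y z} → x ∷ y ∷ z ∷ [] ⊆ xs → y < x → ¬ x < z) →
  (∀ {x y z} → x ∷ y ∷ z ∷ [] ⊆ xs → z < x → ¬ x < y) → Extremal xs
¬213∧¬231⇒Extremal {[]} _ _ _ = []
¬213∧¬231⇒Extremal {x ∷ []} _ _ _ = min [] []
¬213∧¬231⇒Extremal {x ∷ xs@(y ∷ ys)} ((x≢y ∷ x≢ys) ∷ u) ¬213 ¬231 with <-cmp x y
... | tri≈ _ x≡y _ = contradiction x≡y x≢y
... | tri< x<y _ _ = min (x<y ∷ All.tabulate λ z∈ → ≤∧≢⇒<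
        (≮⇒≥ λ z<x → ¬231 (refl ∷ refl ∷ from∈ z∈) z<x x<y) (All.lookup x≢ys z∈))
        (¬213∧¬231⇒Extremal u (¬213 ∘ (x ∷ʳ_)) (¬231 ∘ (x ∷ʳ_)))
... | tri> _ _ y<x = max (y<x ∷ All.tabulate λ z∈ → ≤∧≢⇒<
        (≮⇒≥ (¬213 (refl ∷ refl ∷ from∈ z∈) y<x)) (≢-sym (All.lookup x≢ys z∈)))
        (¬213∧¬231⇒Extremal u (¬213 ∘ (x ∷ʳ_)) (¬231 ∘ (x ∷ʳ_)))

-- Words whose entries make up an interval

-- The interval is half-open, so adjacent intervals share an endpoint. Only the set of entries is
-- fixed; distinctness comes from `Unique` or `Extremal`.
record Fills (lo hi : ℕ) (xs : List ℕ) : Set where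
  constructor fills
  field
    bounds : ∀ {x} → x ∈ xs → lo ≤ x × x < hi
    covers : ∀ {x} → lo ≤ x → x < hi → x ∈ xs
open Fills

Fills-applyUpTo : ∀ n → Fills 1 (suc n) (applyUpTo suc n)
Fills-applyUpTo n .bounds x∈ with _ , i<n , refl ← ∈-applyUpTo⁻ suc x∈ = s≤s z≤n , s≤s i<n
Fills-applyUpTo n .covers {suc x} _ (s≤s x<n) = ∈-applyUpTo⁺ suc x<n

applyUpTo-suc-unique : ∀ n → Unique (applyUpTo suc n)
applyUpTo-suc-unique n = Unique.applyUpTo⁺₁ suc n (λ i<j _ → <⇒≢ (s≤s i<j))

Fills-resp-↭ : ∀ {lo hi xs ys} → xs ↭ ys → Fills lo hi xs → Fills lo hi ys
Fills-resp-↭ p f .bounds x∈    = f .bounds (∈-resp-↭ (↭-sym p) x∈)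
Fills-resp-↭ p f .covers l≤ <h = ∈-resp-↭ p (f .covers l≤ <h)

Fills⇒↭ : ∀ {lo hi xs ys} → Unique xs → Unique ys → Fills lo hi xs → Fills lo hi ys → xs ↭ ys
Fills⇒↭ u v f g = ∼bag⇒↭ (unique∧set⇒bag u v (mk⇔
  (λ x∈ → let l≤ , <h = f .bounds x∈ in g .covers l≤ <h)
  (λ x∈ → let l≤ , <h = g .bounds x∈ in f .covers l≤ <h)))

Fills-[] : ∀ {lo} → Fills lo lo []
Fills-[] = fills (λ ()) (λ l≤ <l → contradiction <l (≤⇒≯ l≤))

Fills-empty : ∀ {lo xs} → Fills lo lo xs → xs ≡ []
Fills-empty {xs = []}     f = refl
Fills-empty {xs = x ∷ xs} f = let l≤ , <l = f .bounds (here refl) in contradiction <l (≤⇒≯ l≤)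

Fills-min : ∀ {lo hi xs} → lo < hi → Fills (suc lo) hi xs → Fills lo hi (lo ∷ xs)
Fills-min l<h f .bounds (here refl) = ≤-refl , l<h
Fills-min l<h f .bounds (there x∈)  = let l< , <h = f .bounds x∈ in <⇒≤ l< , <h
Fills-min l<h f .covers l≤x x<h with m≤n⇒m<n∨m≡n l≤x
... | inj₁ l<x = there (f .covers l<x x<h)
... | inj₂ l≡x = here (sym l≡x)

Fills-max : ∀ {lo hi xs} → lo ≤ hi → Fills lo hi xs → Fills lo (suc hi) (hi ∷ xs)
Fills-max l≤h f .bounds (here refl) = l≤h , ≤-refl
Fills-max l≤h f .bounds (there x∈)  = let l≤ , <h = f .bounds x∈ in l≤ , m<n⇒m<1+n <h
Fills-max l≤h f .covers l≤x x<1+h with m<1+n⇒m<n∨m≡n x<1+h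
... | inj₁ x<h = there (f .covers l≤x x<h)
... | inj₂ x≡h = here x≡h

-- The entry `lo` must be the head: in the tail it would exceed the head, which would then be out of
-- bounds.
Fills-min⁻ : ∀ {lo hi x xs} → lo < hi → All (x <_) xs → Fills lo hi (x ∷ xs) →
             x ≡ lo × Fills (suc lo) hi xs
Fills-min⁻ {lo} {hi} {x} {xs} l<h x<xs f with f .covers ≤-refl l<h
... | there lo∈ = contradiction (f .bounds (here refl) .proj₁) (<⇒≱ (All.lookup x<xs lo∈))
... | here refl = refl , fills
  (λ x∈ → All.lookup x<xs x∈ , f .bounds (there x∈) .proj₂)
  (λ l<y y<h → case (f .covers (<⇒≤ l<y) y<h) l<y)
  where
  case : ∀ {y} → y ∈ x ∷ xs → x < y → y ∈ xs
  case (here refl) x<x = contradiction x<x (<-irrefl refl)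
  case (there y∈)  _   = y∈

Fills-max⁻ : ∀ {lo hi x xs} → lo ≤ hi → All (x >_) xs → Fills lo (suc hi) (x ∷ xs) →
             x ≡ hi × Fills lo hi xs
Fills-max⁻ {lo} {hi} {x} {xs} l≤h x>xs f with f .covers l≤h ≤-refl
... | there hi∈ = contradiction (f .bounds (here refl) .proj₂) (<⇒≱ (s≤s (All.lookup x>xs hi∈)))
... | here refl = refl , fills
  (λ x∈ → f .bounds (there x∈) .proj₁ , All.lookup x>xs x∈)
  (λ l≤y y<h → case (f .covers l≤y (m<n⇒m<1+n y<h)) y<h)
  where
  case : ∀ {y} → y ∈ x ∷ xs → y < x → y ∈ xs
  case (here refl) x<x = contradiction x<x (<-irrefl refl)
  case (there y∈)  _   = y∈

Fills-++ : ∀ {lo mid hi xs ys} → lo ≤ mid → mid ≤ hi →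
           Fills mid hi xs → Fills lo mid ys → Fills lo hi (xs ++ ys)
Fills-++ {xs = xs} l≤m m≤h f g .bounds x∈ with ∈-++⁻ xs x∈
... | inj₁ x∈xs = let m≤ , <h = f .bounds x∈xs in ≤-trans l≤m m≤ , <h
... | inj₂ x∈ys = let l≤ , <m = g .bounds x∈ys in l≤ , <-≤-trans <m m≤h
Fills-++ {mid = mid} {xs = xs} _ _ f g .covers {x} l≤x x<h with x <? mid
... | yes x<m = ∈-++⁺ʳ xs (g .covers l≤x x<m)
... | no  x≮m = ∈-++⁺ˡ (f .covers (≮⇒≥ x≮m) x<h)

-- The cut is just above the greatest entry `m` of `y ∷ ys`: a value above `m` can only be in `xs`,
-- a value up to `m` cannot be there.
Fills-++⁻ : ∀ {lo hi xs y ys} → (∀ {u v} → u ∈ xs → v ∈ y ∷ ys → v < u) →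
            Fills lo hi (xs ++ y ∷ ys) →
            ∃ λ mid → lo < mid × mid ≤ hi × Fills mid hi xs × Fills lo mid (y ∷ ys)
Fills-++⁻ {lo} {hi} {xs} {y} {ys} xs>ys f =
  suc m , s≤s (f .bounds (∈-++⁺ʳ xs m∈) .proj₁) , f .bounds (∈-++⁺ʳ xs m∈) .proj₂ ,
  fills (λ x∈ → xs>ys x∈ m∈ , f .bounds (∈-++⁺ˡ x∈) .proj₂)
        (λ {x} m<x x<h → left m<x (∈-++⁻ xs (f .covers (≤-trans l≤m (<⇒≤ m<x)) x<h))) ,
  fills (λ x∈ → f .bounds (∈-++⁺ʳ xs x∈) .proj₁ , s≤s (≤m x∈))
        (λ {x} l≤x x≤m → right x≤m (∈-++⁻ xs (f .covers l≤x
          (≤-<-trans (s≤s⁻¹ x≤m) (f .bounds (∈-++⁺ʳ xs m∈) .proj₂)))))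
  where
  m = Extrema.max y ys
  m∈ : m ∈ y ∷ ys
  m∈ = argmax-all id {P = _∈ y ∷ ys} (here refl) (All.tabulate there)
  ≤m : ∀ {x} → x ∈ y ∷ ys → x ≤ m
  ≤m (here refl) = ⊥≤max y ys
  ≤m (there x∈)  = All.lookup (xs≤max y ys) x∈
  l≤m : lo ≤ m
  l≤m = f .bounds (∈-++⁺ʳ xs m∈) .proj₁
  left : ∀ {x} → m < x → x ∈ xs ⊎ x ∈ y ∷ ys → x ∈ xs
  left _   (inj₁ x∈) = x∈
  left m<x (inj₂ x∈) = contradiction (≤m x∈) (<⇒≱ m<x)
  right : ∀ {x} → x < suc m → x ∈ xs ⊎ x ∈ y ∷ ys → x ∈ y ∷ ys
  right _   (inj₂ x∈) = x∈
  right x≤m (inj₁ x∈) = contradiction (xs>ys x∈ m∈) (≤⇒≯ (s≤s⁻¹ x≤m))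

-- Listing the extremal words on an interval

up : ℕ → ℕ → List ℕ
up zero    lo = []
up (suc k) lo = lo ∷ up k (suc lo)

down : ℕ → ℕ → List ℕ
down zero    lo = []
down (suc k) lo = k + lo ∷ down k lo

-- The head of a singleton is both least and greatest: without the case 1 it would be listed twice.
words : ℕ → ℕ → List (List ℕ)
words 0             lo = [] ∷ []
words 1             lo = (lo ∷ []) ∷ []
words (suc (suc k)) lo =
  map (lo ∷_) (words (suc k) (suc lo)) ++ map (suc k + lo ∷_) (words (suc k) lo)

nonUp : ℕ → ℕ → List (List ℕ)
nonUp k lo = drop 1 (words k lo)

-- The branch starting with the least letter comes first at every level of `words`, so the first
-- word listed is the increasing one.
words≡up∷nonUp : ∀ k lo → words k lo ≡ up k lo ∷ nonUp k lo
words≡up∷nonUp 0 lo = refl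
words≡up∷nonUp 1 lo = refl
words≡up∷nonUp (suc (suc k)) lo rewrite words≡up∷nonUp (suc k) (suc lo) = refl

Fills-suc : ∀ {k lo xs} → Fills (suc lo) (k + suc lo) xs → Fills (suc lo) (suc k + lo) xs
Fills-suc {k} {lo} {xs} = subst (λ hi → Fills (suc lo) hi xs) (+-suc k lo)

Fills-suc⁻ : ∀ {k lo xs} → Fills (suc lo) (suc k + lo) xs → Fills (suc lo) (k + suc lo) xs
Fills-suc⁻ {k} {lo} {xs} = subst (λ hi → Fills (suc lo) hi xs) (sym (+-suc k lo))

lo<1+k+lo : ∀ k lo → lo < suc k + lo
lo<1+k+lo k lo = s≤s (m≤n+m lo k)

up-fills : ∀ k lo → Fills lo (k + lo) (up k lo)
up-fills zero    lo = Fills-[]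
up-fills (suc k) lo = Fills-min (lo<1+k+lo k lo) (Fills-suc (up-fills k (suc lo)))

down-fills : ∀ k lo → Fills lo (k + lo) (down k lo)
down-fills zero    lo = Fills-[]
down-fills (suc k) lo = Fills-max (m≤n+m lo k) (down-fills k lo)

lo<all : ∀ {lo hi xs} → Fills (suc lo) hi xs → All (lo <_) xs
lo<all f = All.tabulate (λ x∈ → f .bounds x∈ .proj₁)

hi>all : ∀ {lo hi xs} → Fills lo hi xs → All (hi >_) xs
hi>all f = All.tabulate (λ x∈ → f .bounds x∈ .proj₂)

up-increasing : ∀ k lo → AllPairs _<_ (up k lo)
up-increasing zero    lo = []
up-increasing (suc k) lo = lo<all (up-fills k (suc lo)) ∷ up-increasing k (suc lo)

down-decreasing : ∀ k lo → AllPairs _>_ (down k lo)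
down-decreasing zero    lo = []
down-decreasing (suc k) lo = hi>all (down-fills k lo) ∷ down-decreasing k lo

increasing⇒Extremal : ∀ {xs} → AllPairs _<_ xs → Extremal xs
increasing⇒Extremal []       = []
increasing⇒Extremal (p ∷ ps) = min p (increasing⇒Extremal ps)

decreasing⇒Extremal : ∀ {xs} → AllPairs _>_ xs → Extremal xs
decreasing⇒Extremal []       = []
decreasing⇒Extremal (p ∷ ps) = max p (decreasing⇒Extremal ps)

increasing⇒≡up : ∀ {k lo xs} → AllPairs _<_ xs → Fills lo (k + lo) xs → xs ≡ up k lo
increasing⇒≡up {zero}  _ f = Fills-empty f
increasing⇒≡up {suc k} {lo} [] f with () ← f .covers ≤-refl (lo<1+k+lo k lo)
increasing⇒≡up {suc k} {lo} (p ∷ ps) f with refl , g ← Fills-min⁻ (lo<1+k+lo k lo) p f =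
  cong (lo ∷_) (increasing⇒≡up {k} ps (Fills-suc⁻ g))

decreasing⇒≡down : ∀ {k lo xs} → AllPairs _>_ xs → Fills lo (k + lo) xs → xs ≡ down k lo
decreasing⇒≡down {zero}  _ f = Fills-empty f
decreasing⇒≡down {suc k} {lo} [] f with () ← f .covers ≤-refl (lo<1+k+lo k lo)
decreasing⇒≡down {suc k} {lo} (p ∷ ps) f with refl , g ← Fills-max⁻ (m≤n+m lo k) p f =
  cong (k + lo ∷_) (decreasing⇒≡down ps g)

words-sound : ∀ k {lo xs} → xs ∈ words k lo → Extremal xs × Fills lo (k + lo) xs
words-sound 0 (here refl) = [] , Fills-[]
words-sound 1 {lo} (here refl) = min [] [] , up-fills 1 lo
words-sound (suc (suc k)) {lo} xs∈ with ∈-++⁻ (map (lo ∷_) (words (suc k) (suc lo))) xs∈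
... | inj₁ xs∈₁ with _ , ys∈ , refl ← ∈-map⁻ (lo ∷_) xs∈₁ with e , f ← words-sound (suc k) ys∈ =
  min (lo<all f) e , Fills-min (lo<1+k+lo (suc k) lo) (Fills-suc f)
... | inj₂ xs∈₂ with _ , ys∈ , refl ← ∈-map⁻ (suc k + lo ∷_) xs∈₂ with e , f ← words-sound (suc k) ys∈ =
  max (hi>all f) e , Fills-max (m≤n+m lo (suc k)) f

words-complete : ∀ k {lo xs} → Extremal xs → Fills lo (k + lo) xs → xs ∈ words k lo
words-complete 0 _ f = here (Fills-empty f)
words-complete (suc k) {lo} [] f with () ← f .covers ≤-refl (lo<1+k+lo k lo)
words-complete 1 {lo} (min p _) f with refl , g ← Fills-min⁻ (lo<1+k+lo 0 lo) p f =
  here (cong (lo ∷_) (Fills-empty g))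
words-complete 1 (max p _) f with refl , g ← Fills-max⁻ ≤-refl p f =
  here (cong (_ ∷_) (Fills-empty g))
words-complete (suc (suc k)) {lo} (min p e) f with refl , g ← Fills-min⁻ (lo<1+k+lo (suc k) lo) p f =
  ∈-++⁺ˡ (∈-map⁺ (lo ∷_) (words-complete (suc k) e (Fills-suc⁻ g)))
words-complete (suc (suc k)) {lo} (max p e) f with refl , g ← Fills-max⁻ (m≤n+m lo (suc k)) p f =
  ∈-++⁺ʳ (map (lo ∷_) (words (suc k) (suc lo))) (∈-map⁺ (suc k + lo ∷_) (words-complete (suc k) e g))

words-unique : ∀ k lo → Unique (words k lo)
words-unique 0 lo = [] ∷ []
words-unique 1 lo = [] ∷ []
words-unique (suc (suc k)) lo =
  Unique.++⁺ (Unique.map⁺ ∷-injectiveʳ (words-unique (suc k) (suc lo)))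
             (Unique.map⁺ ∷-injectiveʳ (words-unique (suc k) lo)) disjoint
  where
  disjoint : Disjoint (map (lo ∷_) (words (suc k) (suc lo))) (map (suc k + lo ∷_) (words (suc k) lo))
  disjoint (v∈₁ , v∈₂) with _ , _ , refl ← ∈-map⁻ (lo ∷_) v∈₁ with _ , _ , eq ← ∈-map⁻ (suc k + lo ∷_) v∈₂ =
    contradiction (∷-injectiveˡ eq) (<⇒≢ (lo<1+k+lo k lo))

up∷nonUp-unique : ∀ k lo → Unique (up k lo ∷ nonUp k lo)
up∷nonUp-unique k lo = subst Unique (words≡up∷nonUp k lo) (words-unique k lo)

-- The listing of representatives

-- Omitting `up` from the second part keeps the pair (down , up) from being listed twice.
block : ℕ → ℕ → ℕ → List (List ℕ)
block n a b = map (λ A → n ∷ A ++ 1 ∷ up b 2) (words a (b + 2))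
           ++ map (λ B → n ∷ down a (b + 2) ++ 1 ∷ B) (nonUp b 2)

-- Each step moves one letter from A to B. Started at `blocks (2 + m) m 0`, it runs through all
-- splits of the `m` letters other than 1 and n.
blocks : ℕ → ℕ → ℕ → List (List ℕ)
blocks n zero    b = block n zero b
blocks n (suc a) b = block n (suc a) b ++ blocks n a (suc b)

-- A lies above B: the `b` values from 2 on go to `B`, the next `a` values to `A`. The word is a
-- permutation when `n` is the next value, `a + (b + 2)`.
record Shape (n a b : ℕ) (l : List ℕ) : Set where
  constructor shape
  field
    {A B}      : List ℕ
    decomposed : l ≡ n ∷ A ++ 1 ∷ B
    extremalA  : Extremal A
    fillsA     : Fills (b + 2) (a + (b + 2)) A
    extremalB  : Extremal B
    fillsB     : Fills 2 (b + 2) B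
    monotone   : AllPairs _>_ A ⊎ AllPairs _<_ B

block⇒Shape : ∀ {n} a b {l} → l ∈ block n a b → Shape n a b l
block⇒Shape {n} a b l∈ with ∈-++⁻ (map (λ A → n ∷ A ++ 1 ∷ up b 2) (words a (b + 2))) l∈
... | inj₁ l∈₁ with _ , A∈ , refl ← ∈-map⁻ _ l∈₁ with e , f ← words-sound a A∈ =
  shape refl e f (increasing⇒Extremal (up-increasing b 2)) (up-fills b 2) (inj₂ (up-increasing b 2))
... | inj₂ l∈₂ with _ , B∈ , refl ← ∈-map⁻ _ l∈₂
               with e , f ← words-sound b (subst (_ ∈_) (sym (words≡up∷nonUp b 2)) (there B∈)) =
  shape refl (decreasing⇒Extremal (down-decreasing a (b + 2))) (down-fills a (b + 2)) e f
    (inj₁ (down-decreasing a (b + 2)))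

Shape⇒block : ∀ {n} a b {l} → Shape n a b l → l ∈ block n a b
Shape⇒block {n} a b (shape refl eA fA eB fB (inj₂ inc)) with refl ← increasing⇒≡up {b} inc fB =
  ∈-++⁺ˡ (∈-map⁺ _ (words-complete a eA fA))
Shape⇒block {n} a b (shape refl eA fA eB fB (inj₁ dec)) with refl ← decreasing⇒≡down {a} dec fA
  with subst (_ ∈_) (words≡up∷nonUp b 2) (words-complete b eB fB)
-- A decreasing A with an increasing B appears in the first half of the block only.
... | here refl = ∈-++⁺ˡ (∈-map⁺ _ (words-complete a eA fA))
... | there B∈  = ∈-++⁺ʳ (map (λ A → n ∷ A ++ 1 ∷ up b 2) (words a (b + 2))) (∈-map⁺ _ B∈)

-- The equation on sums identifies the greatest letter for `blocks-sound`; the bound `b ≤ b′`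
-- separates a block from the later ones in `blocks-unique`.
blocks⁻ : ∀ {n} a b {l} → l ∈ blocks n a b →
  ∃₂ λ a′ b′ → a′ + (b′ + 2) ≡ a + (b + 2) × b ≤ b′ × Shape n a′ b′ l
blocks⁻ zero    b l∈ = zero , b , refl , ≤-refl , block⇒Shape zero b l∈
blocks⁻ {n} (suc a) b l∈ with ∈-++⁻ (block n (suc a) b) l∈
... | inj₁ l∈₁ = suc a , b , refl , ≤-refl , block⇒Shape (suc a) b l∈₁
... | inj₂ l∈₂ = let a′ , b′ , eq , b<b′ , s = blocks⁻ a (suc b) l∈₂
                 in a′ , b′ , trans eq (+-suc a (b + 2)) , <⇒≤ b<b′ , s

blocks⁺ : ∀ {n} k a b {l} → l ∈ block n a (k + b) → l ∈ blocks n (k + a) b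
blocks⁺ zero    zero    b l∈ = l∈
blocks⁺ zero    (suc a) b l∈ = ∈-++⁺ˡ l∈
blocks⁺ {n} (suc k) a b {l} l∈ = ∈-++⁺ʳ (block n (suc (k + a)) b)
  (blocks⁺ k a (suc b) (subst (λ j → l ∈ block n a j) (sym (+-suc k b)) l∈))

∉-≥2 : ∀ {lo hi xs} → Fills (lo + 2) hi xs → 1 ∉ xs
∉-≥2 {lo} f 1∈ = contradiction (f .bounds 1∈ .proj₁) (<⇒≱ (m≤n+m 2 lo))

block-unique : ∀ n a b → Unique (block n a b)
block-unique n a b with up∉ ∷ nonUp-unique ← up∷nonUp-unique b 2 =
  Unique.++⁺ (Unique.map⁺ (λ eq → ++-cancelʳ _ _ _ (∷-injectiveʳ eq)) (words-unique a (b + 2)))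
             (Unique.map⁺ (λ eq → ∷-injectiveʳ (++-cancelˡ (down a (b + 2)) _ _ (∷-injectiveʳ eq))) nonUp-unique)
             disjoint
  where
  disjoint : Disjoint (map (λ A → n ∷ A ++ 1 ∷ up b 2) (words a (b + 2)))
                      (map (λ B → n ∷ down a (b + 2) ++ 1 ∷ B) (nonUp b 2))
  disjoint (v∈₁ , v∈₂)
    with A , A∈ , refl ← ∈-map⁻ _ v∈₁ with B , B∈ , eq ← ∈-map⁻ _ v∈₂
    with _ , refl ← ++-∷-split A (down a (b + 2)) (∉-≥2 {b} (words-sound a A∈ .proj₂))
                      (∉-≥2 {b} (down-fills a (b + 2))) (∷-injectiveʳ eq) =
    All.lookup up∉ B∈ refl

-- Splitting at the 1 gives the same B for both shapes. It would contain `b + 2` by the second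
-- shape, which is out of bounds by the first.
Shape-disjoint : ∀ {n a b a′ b′ l} → b < b′ → Shape n a b l → ¬ Shape n a′ b′ l
Shape-disjoint {b = b} {b′ = b′} b<b′ (shape {A} refl _ fA _ fB _) (shape {A′} eq _ fA′ _ fB′ _)
  with _ , refl ← ++-∷-split A A′ (∉-≥2 {b} fA) (∉-≥2 {b′} fA′) (∷-injectiveʳ eq) =
  <-irrefl refl (fB .bounds (fB′ .covers (m≤n+m 2 b) (+-monoˡ-< 2 b<b′)) .proj₂)

blocks-unique : ∀ n a b → Unique (blocks n a b)
blocks-unique n zero    b = block-unique n zero b
blocks-unique n (suc a) b =
  Unique.++⁺ (block-unique n (suc a) b) (blocks-unique n a (suc b)) λ (v∈₁ , v∈₂) →
    let _ , _ , _ , b<b′ , s = blocks⁻ a (suc b) v∈₂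
    in Shape-disjoint b<b′ (block⇒Shape (suc a) b v∈₁) s

-- Listed words avoid the pattern

module _ {n : ℕ} {A C : List ℕ} (A>C : ∀ {x y} → x ∈ A → y ∈ C → y < x)
         (extremalA : Extremal A) (extremalC : Extremal C) where

  -- `C` will be `1 ∷ B`. An occurrence divided between `A` and `C` has its 2 in `A` and its 3 in
  -- `C`, against `A>C`.
  ++-¬213 : ∀ {x y z} → x ∷ y ∷ z ∷ [] ⊆ A ++ C → y < x → ¬ x < z
  ++-¬213 s y<x x<z with ⊆-++⁻ A s
  ... | [] , _ , refl , _ , sC = Extremal-¬213 extremalC sC y<x x<z
  ... | _ ∷ [] , _ , refl , sA , sC = <-asym x<z (A>C (to∈ sA) (to∈ (∷ˡ⁻ sC)))
  ... | _ ∷ _ ∷ [] , _ , refl , sA , sC = <-asym x<z (A>C (to∈ sA) (to∈ sC))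
  ... | _ ∷ _ ∷ _ ∷ [] , _ , refl , sA , _ = Extremal-¬213 extremalA sA y<x x<z

  -- A divided occurrence has its 1 in `A` and its 2 in `C`, against `A>C`; an undivided one
  -- contains the 231 formed by 342.
  ++-¬1342 : ∀ {a b c d} → a < d → d < b → b < c → ¬ a ∷ b ∷ c ∷ d ∷ [] ⊆ A ++ C
  ++-¬1342 a<d d<b b<c s with ⊆-++⁻ A s
  ... | [] , _ , refl , _ , sC = Extremal-¬231 extremalC (∷ˡ⁻ sC) d<b b<c
  ... | _ ∷ [] , _ , refl , sA , sC = <-asym a<d (A>C (to∈ sA) (to∈ (∷ˡ⁻ (∷ˡ⁻ sC))))
  ... | _ ∷ _ ∷ [] , _ , refl , sA , sC = <-asym a<d (A>C (to∈ sA) (to∈ (∷ˡ⁻ sC)))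
  ... | _ ∷ _ ∷ _ ∷ [] , _ , refl , sA , sC = <-asym a<d (A>C (to∈ sA) (to∈ sC))
  ... | _ ∷ _ ∷ _ ∷ _ ∷ [] , _ , refl , sA , _ = Extremal-¬231 extremalA (∷ˡ⁻ sA) d<b b<c

  -- The letters 342 form a 231, so they cannot share a part, and 3 in `A` with 4 in `C` contradicts
  -- `A>C`. Only the division 34 | 21 is left, with an ascent in `A` and a descent in `C`.
  ++-¬3421 : AllPairs _>_ A ⊎ AllPairs _<_ C →
             ∀ {a b c d} → a < d → d < b → b < c → ¬ b ∷ c ∷ d ∷ a ∷ [] ⊆ A ++ C
  ++-¬3421 monotone a<d d<b b<c s with ⊆-++⁻ A s
  ... | [] , _ , refl , _ , sC =
    Extremal-¬231 extremalC (⊆-trans (refl ∷ refl ∷ refl ∷ minimum _) sC) d<b b<c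
  ... | _ ∷ [] , _ , refl , sA , sC = <-asym b<c (A>C (to∈ sA) (to∈ sC))
  ... | _ ∷ _ ∷ _ ∷ [] , _ , refl , sA , _ = Extremal-¬231 extremalA sA d<b b<c
  ... | _ ∷ _ ∷ _ ∷ _ ∷ [] , _ , refl , sA , _ =
    Extremal-¬231 extremalA (⊆-trans (refl ∷ refl ∷ refl ∷ minimum _) sA) d<b b<c
  ... | _ ∷ _ ∷ [] , _ , refl , sA , sC with monotone
  ...   | inj₁ dec = <-asym b<c (AllPairs-lookup sA dec)
  ...   | inj₂ inc = <-asym a<d (AllPairs-lookup sC inc)

  -- The leading `n` can only be the 4 of a 4213, which leaves a 213 behind it. Without `n`, both
  -- 4213 and 2134 contain a 213.
  ∷-++-clean : All (n >_) (A ++ C) → AllPairs _>_ A ⊎ AllPairs _<_ C → Clean (n ∷ A ++ C)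
  ∷-++-clean n> monotone = λ where
      (r1342 a<d d<b b<c) (_ ∷ʳ s) → ++-¬1342 a<d d<b b<c s
      (r3421 a<d d<b b<c) (_ ∷ʳ s) → ++-¬3421 monotone a<d d<b b<c s
      (r4213 a<d d<b b<c) (_ ∷ʳ s) → ++-¬213 (∷ˡ⁻ s) a<d d<b
      (r2134 a<d d<b b<c) (_ ∷ʳ s) →
        ++-¬213 (⊆-trans (refl ∷ refl ∷ refl ∷ minimum _) s) a<d d<b
      (r1342 a<d d<b b<c) (refl ∷ s) → <-asym a<d (top (∷ˡ⁻ (∷ˡ⁻ s)))
      (r3421 a<d d<b b<c) (refl ∷ s) → <-asym b<c (top s)
      (r4213 a<d d<b b<c) (refl ∷ s) → ++-¬213 s a<d d<b
      (r2134 a<d d<b b<c) (refl ∷ s) → <-asym d<b (top (∷ˡ⁻ s))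
    where
    top : ∀ {x xs} → x ∷ xs ⊆ A ++ C → x < n
    top s = All.lookup n> (to∈ s)

module _ {a b : ℕ} {l : List ℕ} (s : Shape (a + (b + 2)) a b l) where
  open Shape s

  private
    extremalC : Extremal (1 ∷ B)
    extremalC = min (lo<all fillsB) extremalB

    fillsC : Fills 1 (b + 2) (1 ∷ B)
    fillsC = Fills-min (m≤n+m 2 b) fillsB

    A>C : ∀ {x y} → x ∈ A → y ∈ 1 ∷ B → y < x
    A>C x∈ y∈ = <-≤-trans (fillsC .bounds y∈ .proj₂) (fillsA .bounds x∈ .proj₁)

    1≤b+2 : 1 ≤ b + 2
    1≤b+2 = ≤-trans (s≤s z≤n) (m≤n+m 2 b)

    fillsAC : Fills 1 (a + (b + 2)) (A ++ 1 ∷ B)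
    fillsAC = Fills-++ 1≤b+2 (m≤n+m (b + 2) a) fillsA fillsC

    monotoneC : AllPairs _>_ A ⊎ AllPairs _<_ (1 ∷ B)
    monotoneC with monotone
    ... | inj₁ dec = inj₁ dec
    ... | inj₂ inc = inj₂ (lo<all fillsB ∷ inc)

  Shape⇒↭ : l ↭ applyUpTo suc (a + (b + 2))
  Shape⇒↭ = subst (_↭ _) (sym decomposed)
    (Fills⇒↭ (All.map >⇒≢ (hi>all fillsAC) ∷
                Unique.++⁺ (Extremal⇒Unique extremalA) (Extremal⇒Unique extremalC)
                  (λ (x∈A , x∈C) → <-irrefl refl (A>C x∈A x∈C)))
              (applyUpTo-suc-unique _)
              (Fills-max (≤-trans 1≤b+2 (m≤n+m (b + 2) a)) fillsAC)
              (Fills-applyUpTo _))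

  Shape⇒clean : Clean l
  Shape⇒clean = subst Clean (sym decomposed)
    (∷-++-clean A>C extremalA extremalC (hi>all fillsAC) monotoneC)

-- Avoiders have the listed shape

module _ {n : ℕ} {A B : List ℕ} (unique : Unique (n ∷ A ++ 1 ∷ B))
         (fillsAll : Fills 1 (suc n) (n ∷ A ++ 1 ∷ B))
         (clean : Clean (n ∷ A ++ 1 ∷ B)) where

  private
    1≤n : 1 ≤ n
    1≤n = fillsAll .bounds (here refl) .proj₁

    A⊆ : ∀ {σ} → σ ⊆ A → σ ++ 1 ∷ [] ⊆ n ∷ A ++ 1 ∷ B
    A⊆ s = n ∷ʳ ++⁺ s (refl ∷ minimum _)

    B⊆ : ∀ {σ} → σ ⊆ B → 1 ∷ σ ⊆ n ∷ A ++ 1 ∷ B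
    B⊆ s = n ∷ʳ ++⁺ˡ A (refl ∷ s)

    n> : All (n >_) (A ++ 1 ∷ B)
    n> = All.tabulate λ x∈ →
      ≤∧≢⇒< (s≤s⁻¹ (fillsAll .bounds (there x∈) .proj₂)) (≢-sym (All.lookup (AllPairs.head unique) x∈))

    fillsAC : Fills 1 n (A ++ 1 ∷ B)
    fillsAC = Fills-max⁻ 1≤n n> fillsAll .proj₂

    ¬213 : ∀ {x y z} → x ∷ y ∷ z ∷ [] ⊆ A ++ 1 ∷ B → y < x → ¬ x < z
    ¬213 s y<x x<z = clean (r4213 y<x x<z (All.lookup n> (to∈ (∷ˡ⁻ (∷ˡ⁻ s))))) (refl ∷ s)

    uniqueC : Unique (1 ∷ B)
    uniqueC = AllPairs-resp-⊆ (n ∷ʳ ++⁺ˡ A ⊆-refl) unique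

    1<B : All (1 <_) B
    1<B with 1∉ ∷ _ ← uniqueC = All.tabulate λ x∈ →
      ≤∧≢⇒< (fillsAC .bounds (∈-++⁺ʳ A (there x∈)) .proj₁) (All.lookup 1∉ x∈)

    1<A : ∀ {x} → x ∈ A → 1 < x
    1<A x∈ = ≤∧≢⇒< (fillsAC .bounds (∈-++⁺ˡ x∈) .proj₁)
      (≢-sym (AllPairs-lookup (A⊆ (from∈ x∈)) unique))

    A>C : ∀ {x y} → x ∈ A → y ∈ 1 ∷ B → y < x
    A>C x∈ (here refl) = 1<A x∈
    A>C x∈ (there y∈)  = ≤∧≢⇒<
      -- Otherwise `x`, 1, `y` would form a 213.
      (≮⇒≥ (¬213 (++⁺ (from∈ x∈) (refl ∷ from∈ y∈)) (1<A x∈)))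
      (≢-sym (AllPairs-lookup (n ∷ʳ ++⁺ (from∈ x∈) (1 ∷ʳ from∈ y∈)) unique))

    extremalA : Extremal A
    extremalA = ¬213∧¬231⇒Extremal (AllPairs-resp-⊆ (n ∷ʳ ++⁺ʳ (1 ∷ B) ⊆-refl) unique)
      (λ s → ¬213 (++⁺ʳ (1 ∷ B) s))
      (λ s z<x x<y → clean (r3421 (1<A (to∈ (∷ˡ⁻ (∷ˡ⁻ s)))) z<x x<y) (A⊆ s))

    extremalB : Extremal B
    extremalB with _ ∷ uniqueB ← uniqueC = ¬213∧¬231⇒Extremal uniqueB
      (λ s → ¬213 (++⁺ˡ A (1 ∷ʳ s)))
      (λ s z<x x<y → clean (r1342 (All.lookup 1<B (to∈ (∷ˡ⁻ (∷ˡ⁻ s)))) z<x x<y) (B⊆ s))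

    monotone : AllPairs _>_ A ⊎ AllPairs _<_ B
    monotone with AllPairs⊎⊆ _>?_ A | AllPairs⊎⊆ _<?_ B
    ... | inj₁ dec | _        = inj₁ dec
    ... | inj₂ _   | inj₁ inc = inj₂ inc
    -- The ascent `x y` in A serves as 34 and the descent `u v` in B as 21.
    ... | inj₂ (x , y , sA , x≯y) | inj₂ (u , v , sB , u≮v) = contradiction (n ∷ʳ ++⁺ sA (1 ∷ʳ sB))
      (clean (r3421 v<u (A>C (to∈ sA) (there (to∈ sB))) x<y))
      where
      x<y = ≤∧≢⇒< (≮⇒≥ x≯y) (AllPairs-lookup (n ∷ʳ ++⁺ʳ (1 ∷ B) sA) unique)
      v<u = ≤∧≢⇒< (≮⇒≥ u≮v) (≢-sym (AllPairs-lookup (n ∷ʳ ++⁺ˡ A (1 ∷ʳ sB)) unique))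

  clean⇒Shape : ∃₂ λ a b → a + (b + 2) ≡ n × Shape n a b (n ∷ A ++ 1 ∷ B)
  clean⇒Shape with mid , 1<mid , mid≤n , fillsA , fillsC ← Fills-++⁻ A>C fillsAC =
    -- Here `mid` is one more than the greatest entry of `1 ∷ B`, that is `b + 2`. The bounds
    -- `1 < mid` and `mid ≤ n` make both truncated subtractions exact.
    n ∸ mid , mid ∸ 2 , trans (cong (n ∸ mid +_) mid≡) (m∸n+n≡m mid≤n) ,
    shape refl extremalA
      (subst₂ (λ lo hi → Fills lo hi A) (sym mid≡)
        (sym (trans (cong (n ∸ mid +_) mid≡) (m∸n+n≡m mid≤n))) fillsA)
      extremalB
      (subst (λ hi → Fills 2 hi B) (sym mid≡) (Fills-min⁻ 1<mid 1<B fillsC .proj₂))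
      monotone
    where
    mid≡ : mid ∸ 2 + 2 ≡ mid
    mid≡ = m∸n+n≡m 1<mid

-- The listing as a system of representatives

blocks-complete : ∀ m {π} → π ↭ applyUpTo suc (2 + m) → Avoids τ₁₃₄₂ π →
                  ∃ λ l → l ∈ blocks (2 + m) m 0 × π ≈ʳ l
blocks-complete m {π} π↭ av
  with us , vs , refl ← ∈-∃++ (∈-resp-↭ (↭-sym π↭) (∈-applyUpTo⁺ suc {i = suc m} ≤-refl)) =
  ρ , body , π≈ρ
  where
  n = 2 + m
  ρ = n ∷ vs ++ us
  π≈ρ : us ++ n ∷ vs ≈ʳ ρ
  π≈ρ = us , n ∷ vs , refl , refl
  ρ↭ : ρ ↭ applyUpTo suc n
  ρ↭ = ↭-trans (↭-++-comm (n ∷ vs) us) π↭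
  -- As `n` is at least 2, the 1 is found behind the leading `n`.
  skip-n : 1 ∈ ρ → 1 ∈ vs ++ us
  skip-n (there 1∈) = 1∈
  body : ρ ∈ blocks n m 0
  body with A , B , eq ← ∈-∃++ (skip-n (∈-resp-↭ (↭-sym ρ↭) (here refl)))
    with a , b , a+b+2≡n , s ← clean⇒Shape
      (subst (Unique ∘ (n ∷_)) eq
        (Unique-resp-↭ (↭-sym ρ↭) (applyUpTo-suc-unique n)))
      (subst (Fills 1 (suc n) ∘ (n ∷_)) eq (Fills-resp-↭ (↭-sym ρ↭) (Fills-applyUpTo n)))
      (subst (Clean ∘ (n ∷_)) eq (avoids⇒clean (Avoids-resp-≈ʳ {τ₁₃₄₂} π≈ρ av))) =
    subst₂ (λ k l → l ∈ blocks n k 0) b+a≡m (sym (cong (n ∷_) eq))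
      (blocks⁺ b a 0 (subst (λ j → _ ∈ block n a j) (sym (+-identityʳ b)) (Shape⇒block a b s)))
    where
    b+a≡m : b + a ≡ m
    b+a≡m = +-cancelʳ-≡ 2 (b + a) m
      (trans (cong (_+ 2) (+-comm b a)) (trans (+-assoc a b 2) (trans a+b+2≡n (+-comm 2 m))))

Shape-sound : ∀ {n a b l} → a + (b + 2) ≡ n → Shape n a b l →
              l ↭ applyUpTo suc n × Avoids τ₁₃₄₂ l
Shape-sound refl s = Shape⇒↭ s , clean⇒avoids (Shape⇒clean s)

blocks-sound : ∀ m {l} → l ∈ blocks (2 + m) m 0 → l ↭ applyUpTo suc (2 + m) × Avoids τ₁₃₄₂ l
blocks-sound m l∈ = let a , b , eq , _ , s = blocks⁻ m 0 l∈ in Shape-sound (trans eq (+-comm m 2)) s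

-- All listed words start with n, which occurs once in each, so only a trivial rotation relates two
-- of them.
blocks-distinct : ∀ m {l l′} → l ∈ blocks (2 + m) m 0 → l′ ∈ blocks (2 + m) m 0 → l ≈ʳ l′ → l ≡ l′
blocks-distinct m l∈ l′∈ l≈l′
  with _ , _ , _ , _ , shape refl _ _ _ _ _ ← blocks⁻ m 0 l∈
  with _ , _ , _ , _ , shape refl _ _ _ _ _ ← blocks⁻ m 0 l′∈ =
  ≈ʳ-∷⇒≡ (Unique.Unique[x∷xs]⇒x∉xs
    (Unique-resp-↭ (↭-sym (blocks-sound m l∈ .proj₁)) (applyUpTo-suc-unique _))) l≈l′

-- The size of the listing

length-words : ∀ k lo → length (words (suc k) lo) ≡ 2 ^ k
length-words zero    lo = refl
length-words (suc k) lo = begin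
  length (map (lo ∷_) ws ++ map (suc k + lo ∷_) ws′)             ≡⟨ length-++ (map (lo ∷_) ws) ⟩
  length (map (lo ∷_) ws) + length (map (suc k + lo ∷_) ws′)     ≡⟨ cong₂ _+_ (length-map _ ws) (length-map _ ws′) ⟩
  length ws + length ws′                                         ≡⟨ cong₂ _+_ (length-words k (suc lo)) (length-words k lo) ⟩
  2 ^ k + 2 ^ k                                                  ≡⟨ cong (2 ^ k +_) (+-identityʳ (2 ^ k)) ⟨
  2 ^ suc k                                                      ∎
  where
  open ≡-Reasoning
  ws  = words (suc k) (suc lo)
  ws′ = words (suc k) lo

-- What the second halves of the blocks with fewer than `b` letters in B contribute: the partial sum
-- of g(i) - 1 over i < b.
nonUps : ℕ → ℕ
nonUps zero    = 0
nonUps (suc b) = length (nonUp b 2) + nonUps b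

length-block : ∀ n a b → length (block n a b) ≡ length (words a (b + 2)) + length (nonUp b 2)
length-block n a b = trans (length-++ (map _ (words a (b + 2))))
  (cong₂ _+_ (length-map _ (words a (b + 2))) (length-map _ (nonUp b 2)))

-- The first halves have sizes g(a), ..., g(0), with sum `2 ^ a`. Adding `nonUps b` on the left
-- completes the second halves to a partial sum from 0 and avoids subtraction.
length-blocks : ∀ n a b → length (blocks n a b) + nonUps b ≡ 2 ^ a + nonUps (a + suc b)
length-blocks n zero    b = cong (_+ nonUps b) (length-block n zero b)
length-blocks n (suc a) b = begin
  length (block n (suc a) b ++ blocks n a (suc b)) + nonUps b   ≡⟨ cong (_+ nonUps b) (length-++ (block n (suc a) b)) ⟩
  length (block n (suc a) b) + length (blocks n a (suc b)) + nonUps b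
    ≡⟨ cong (λ t → t + length (blocks n a (suc b)) + nonUps b)
            (trans (length-block n (suc a) b) (cong (_+ length (nonUp b 2)) (length-words a (b + 2)))) ⟩
  2 ^ a + length (nonUp b 2) + length (blocks n a (suc b)) + nonUps b
    ≡⟨ regroup (2 ^ a) (length (nonUp b 2)) (length (blocks n a (suc b))) (nonUps b) ⟩
  2 ^ a + (length (blocks n a (suc b)) + nonUps (suc b))        ≡⟨ cong (2 ^ a +_) (length-blocks n a (suc b)) ⟩
  2 ^ a + (2 ^ a + nonUps (a + suc (suc b)))                    ≡⟨ cong (λ t → 2 ^ a + (2 ^ a + nonUps t)) (+-suc a (suc b)) ⟩
  2 ^ a + (2 ^ a + nonUps (suc a + suc b))                      ≡⟨ double (2 ^ a) (nonUps (suc a + suc b)) ⟩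
  2 ^ suc a + nonUps (suc a + suc b)                            ∎
  where
  open ≡-Reasoning
  regroup : ∀ p q r s → p + q + r + s ≡ p + (r + (q + s))
  regroup = solve-∀
  double : ∀ p q → p + (p + q) ≡ 2 * p + q
  double = solve-∀

-- The summand `suc a` restores the one increasing word left out at each length from 0 to `a`; what
-- results is g(0) + ... + g(a).
nonUps-suc : ∀ a → nonUps (suc a) + suc a ≡ 2 ^ a
nonUps-suc zero    = refl
nonUps-suc (suc a) = begin
  length (nonUp (suc a) 2) + nonUps (suc a) + suc (suc a)   ≡⟨ regroup (length (nonUp (suc a) 2)) (nonUps (suc a)) (suc a) ⟩
  suc (length (nonUp (suc a) 2)) + (nonUps (suc a) + suc a) ≡⟨ cong₂ _+_ (trans (cong length (sym (words≡up∷nonUp (suc a) 2))) (length-words a 2)) (nonUps-suc a) ⟩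
  2 ^ a + 2 ^ a                                             ≡⟨ cong (2 ^ a +_) (+-identityʳ (2 ^ a)) ⟨
  2 ^ suc a                                                 ∎
  where
  open ≡-Reasoning
  regroup : ∀ p q r → p + q + suc r ≡ suc p + (q + r)
  regroup = solve-∀

length-all-blocks : ∀ m → length (blocks (2 + m) m 0) ≡ 2 ^ suc m ∸ suc m
length-all-blocks m = begin
  len                           ≡⟨ m+n∸n≡m len (suc m) ⟨
  len + suc m ∸ suc m           ≡⟨ cong (_∸ suc m) total ⟩
  2 ^ suc m ∸ suc m             ∎
  where
  open ≡-Reasoning
  len = length (blocks (2 + m) m 0)
  total : len + suc m ≡ 2 ^ suc m
  total = begin
    len + suc m                     ≡⟨ cong (_+ suc m) (+-identityʳ len) ⟨
    len + 0 + suc m                 ≡⟨ cong (_+ suc m) (length-blocks (2 + m) m 0) ⟩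
    2 ^ m + nonUps (m + 1) + suc m  ≡⟨ cong (λ t → 2 ^ m + nonUps t + suc m) (+-comm m 1) ⟩
    2 ^ m + nonUps (suc m) + suc m  ≡⟨ +-assoc (2 ^ m) (nonUps (suc m)) (suc m) ⟩
    2 ^ m + (nonUps (suc m) + suc m) ≡⟨ cong (2 ^ m +_) (trans (nonUps-suc m) (sym (+-identityʳ (2 ^ m)))) ⟩
    2 ^ suc m                       ∎

theorem2 : ∀ (n : ℕ) → .{{_ : NonZero n}} →
    HasCardinality (avoiders (1 ∷ 3 ∷ 4 ∷ 2 ∷ []) n) (2 ^ (n ∸ 1) ∸ (n ∸ 1))
-- With a single letter, n and 1 coincide and there is no word n A 1 B, so the only arrangement is
-- listed directly.
theorem2 1 = listing⇒cardinality {n = 1} ((1 ∷ []) ∷ []) ([] ∷ [])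
  (λ { (here refl) → ↭-refl , clean⇒avoids λ where
         (r1342 _ _ _) (_ ∷ʳ ())
         (r3421 _ _ _) (_ ∷ʳ ())
         (r4213 _ _ _) (_ ∷ʳ ())
         (r2134 _ _ _) (_ ∷ʳ ()) })
  (λ { (here refl) (here refl) _ → refl })
  (λ π↭ _ → _ , here refl , subst (_≈ʳ _) (sym (↭-singleton-inv π↭)) ≈ʳ-refl)
theorem2 (suc (suc m)) = subst (HasCardinality (avoiders τ₁₃₄₂ (2 + m))) (length-all-blocks m)
  (listing⇒cardinality (blocks (2 + m) m 0) (blocks-unique (2 + m) m 0)
    (blocks-sound m) (blocks-distinct m) (blocks-complete m))
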